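{- Let $x\ge 1$ be real, let $l\ge 2$ be an integer, put $t=\lfloor \log_l x\rfloor$, and let $j$ be an integer with $0\le j\le t-1$. Define $$\tau=\tau(x,j,l)=\min\left(t-j,\ \left\lceil \frac{\{\log_l x\}\log l+j\log l}{\log(l+1)-\log l}\right\rceil\right),$$ for $i=0,\dots,\tau$ $$x_i=l^{\{\log_l x\}}\,l^{\,i+j},\qquad \kappa_i=F_i(x_i,\,l+1),$$ and for $m=0,\dots,\tau$ $$v_m=\sum_{i=m}^{\tau}\kappa_i\,s(i,m)\,\frac{1}{i!}.$$ Then $F_{t-j}(x,l)=P_\tau(t-j)$, where $P_\tau$ is a polynomial of degree $\tau$ in $t-j$ given by $$P_\tau(t-j)=\sum_{m=0}^{\tau}v_m\,(t-j)^m.$$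
   Context: For integers $n\ge1$, $k\ge 1$, $l\ge 1$, $f_k(n,l)=\#\{(i_1,\dots,i_k)\in\mathbb{Z}^k : i_1,\dots,i_k\ge l,\ i_1\cdots i_k=n\}$ is the number of ordered factorizations of $n$ into exactly $k$ factors, each at least $l$. For $k=0$: $f_0(1,l)=1$ and $f_0(n,l)=0$ for $n\ge 2$. For real $y\ge 1$, $F_k(y,l)=\sum_{1\le n\le y} f_k(n,l)$; in particular $F_0(y,l)=1$ for $y\ge1$. $\lfloor y\rfloor$ and $\lceil y\rceil$ denote the usual floor and ceiling of $y$, and $\{y\}=y-\lfloor y\rfloor$ denotes the fractional part. $s(i,m)$ denotes the (signed) Stirling numbers of the first kind, i.e. $\binom{X}{i}=\frac1{i!}\sum_{m=0}^{i}s(i,m)X^m$.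
   Formalization: "Polynomial of degree τ" is read as degree at most τ with the stated coefficients v_0,…,v_τ; exact degree τ can fail, e.g. x=24, l=2, j=1 gives t=4, τ=3 and κ_3=F_3(24,3)=0, so v_3=0. -}

module Defs where

open import Algebra.Bundles using (CommutativeRing)
import Algebra.Definitions.RawSemiring as RawSemiringDefs
import Algebra.Properties.Semiring.Mult as SemiringMult
open import Data.Integer.Base as ℤ using (ℤ; +_; -[1+_]; ∣_∣)
open import Data.Fin.Base using (toℕ)
open import Data.List.Base as List
  using (List; []; _∷_; applyUpTo; cartesianProductWith; filter; length; upTo)
open import Data.Nat.Base as ℕ using (ℕ; zero; suc; _!)
import Data.Nat.ListAction as ℕList
import Data.Nat.Properties as ℕₚ
open import Data.Product.Base using (∃; ∃-syntax; _×_)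
open import Data.Rational.Base as ℚ using (ℚ; 0ℚ)
open import Data.Vec.Base as Vec using (Vec; []; _∷_)
open import Data.Vec.Functional using (Vector)
open import Data.Vec.Relation.Unary.All using (all?)
open import Level using (0ℓ) renaming (suc to lsuc)
import Relation.Binary.Construct.NonStrictToStrict as ToStrict
open import Relation.Binary.Core using (Rel)
open import Relation.Binary.Structures using (IsDecTotalOrder)
open import Relation.Nullary.Decidable.Core using (_×-dec_)
open import Relation.Nullary.Negation.Core using (¬_)

module _ (R : CommutativeRing 0ℓ 0ℓ) where
  open CommutativeRing R
  open SemiringMult semiring using () renaming (_×_ to _×ₙ_)

  castℕ : ℕ → Carrier
  castℕ n = n ×ₙ 1#

  castℤ : ℤ → Carrier
  castℤ (+ n)    = castℕ n
  castℤ -[1+ n ] = - castℕ (suc n)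

-- The real numbers of classical mathematics: a complete ordered field, which
-- is unique up to isomorphism.  The operations floor, exp and log are
-- determined by their specifications (1 + y ≤ exp y fixes the base e), except
-- that _⁻¹ is unspecified at 0 and log is unspecified on nonpositive arguments.
record RealNumbers : Set (lsuc 0ℓ) where
  infix  4 _≤_ _<_
  infix  8 _⁻¹
  infixl 7 _÷_
  field
    commutativeRing : CommutativeRing 0ℓ 0ℓ

  open CommutativeRing commutativeRing public renaming (Carrier to ℝ)

  field
    0≉1 : ¬ (0# ≈ 1#)
    _⁻¹ : ℝ → ℝ
    ⁻¹-inverse : ∀ y → ¬ (y ≈ 0#) → y * y ⁻¹ ≈ 1#
    _≤_ : Rel ℝ 0ℓ
    isDecTotalOrder : IsDecTotalOrder _≈_ _≤_
    +-monoˡ-≤ : ∀ w {y z} → y ≤ z → y + w ≤ z + w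
    *-nonNeg : ∀ {y z} → 0# ≤ y → 0# ≤ z → 0# ≤ y * z

  _<_ : Rel ℝ 0ℓ
  _<_ = ToStrict._<_ _≈_ _≤_

  _÷_ : ℝ → ℝ → ℝ
  y ÷ z = y * z ⁻¹

  UpperBound : (ℝ → Set) → ℝ → Set
  UpperBound S b = ∀ y → S y → y ≤ b

  field
    complete : (S : ℝ → Set) → ∃ S → ∃ (UpperBound S) →
               ∃[ s ] UpperBound S s × (∀ b → UpperBound S b → s ≤ b)

  fromℕ : ℕ → ℝ
  fromℕ = castℕ commutativeRing

  fromℤ : ℤ → ℝ
  fromℤ = castℤ commutativeRing

  field
    ⌊_⌋ : ℝ → ℤ
    floor-≤ : ∀ y → fromℤ ⌊ y ⌋ ≤ y
    <-floor : ∀ y → y < fromℤ ⌊ y ⌋ + 1#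
    exp : ℝ → ℝ
    exp-cong : ∀ {y z} → y ≈ z → exp y ≈ exp z
    exp-+ : ∀ y z → exp (y + z) ≈ exp y * exp z
    1+y≤exp-y : ∀ y → 1# + y ≤ exp y
    log : ℝ → ℝ
    exp-log : ∀ y → 0# < y → exp (log y) ≈ y

  ⌈_⌉ : ℝ → ℤ
  ⌈ y ⌉ = ℤ.- ⌊ - y ⌋

  frac : ℝ → ℝ
  frac y = y - fromℤ ⌊ y ⌋

  logBase : ℕ → ℝ → ℝ
  logBase l y = log y ÷ log (fromℕ l)

  _^ʳ_ : ℕ → ℝ → ℝ
  l ^ʳ y = exp (y * log (fromℕ l))

tuples : {A : Set} (k : ℕ) → List A → List (Vec A k)
tuples zero    as = [] ∷ []
tuples (suc k) as = cartesianProductWith _∷_ as (tuples k as)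

-- For n, l ≥ 1, integers ≥ l with product n are positive and at most n, so
-- searching the k-tuples over {0,…,n} finds all the factorizations in ℤᵏ.
-- The empty tuple has product 1, which gives the convention for k = 0.
f : ℕ → ℕ → ℕ → ℕ
f k n l = length (filter
  (λ is → all? (l ℕₚ.≤?_) is ×-dec (Vec.foldr′ ℕ._*_ 1 is ℕₚ.≟ n))
  (tuples k (upTo (suc n))))

-- Coefficient sequences of integer polynomials in X: X− a · p is (X - a) p.
X−_·_ : ℕ → (ℕ → ℤ) → (ℕ → ℤ)
(X− a · p) zero    = ℤ.- (+ a ℤ.* p zero)
(X− a · p) (suc m) = p m ℤ.- + a ℤ.* p (suc m)

-- X (X - 1) ⋯ (X - i + 1), that is, i! times the binomial coefficient (X choose i).
fallingFactorial : ℕ → (ℕ → ℤ)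
fallingFactorial zero    zero    = + 1
fallingFactorial zero    (suc _) = + 0
fallingFactorial (suc i)         = X− i · fallingFactorial i

-- Signed Stirling numbers of the first kind.
s : ℕ → ℕ → ℤ
s i m = fallingFactorial i m

fromℕ-ℚ : ℕ → ℚ
fromℕ-ℚ n = + n ℚ./ 1

1/_! : ℕ → ℚ
1/ i ! = (+ 1 ℚ./ (i !)) {{i ℕₚ.!≢0}}

-- The sum of g i over a ≤ i ≤ b.
∑[_⋯_] : ℕ → ℕ → (ℕ → ℚ) → ℚ
∑[ a ⋯ b ] g = List.foldr ℚ._+_ 0ℚ (applyUpTo (λ i → g (a ℕ.+ i)) (suc b ℕ.∸ a))

-- Polynomials of formal degree d over ℚ: coefficients of X⁰, …, Xᵈ, where the
-- coefficient of Xᵈ may vanish.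
Polynomial : ℕ → Set
Polynomial d = Vector ℚ (suc d)

eval : ∀ {d} → Polynomial d → ℚ → ℚ
eval p X = sum (λ m → p m ℚ.* X ^ toℕ m)
  where open RawSemiringDefs ℚ.+-*-rawSemiring using (sum; _^_)

module Factorizations (𝓡 : RealNumbers) where
  open RealNumbers 𝓡

  -- Meant for y ≥ 0 (in particular y ≥ 1), where ∣ ⌊ y ⌋ ∣ is just ⌊ y ⌋.
  F : ℕ → ℝ → ℕ → ℕ
  F k y l = ℕList.sum (applyUpTo (λ n → f k (suc n) l) ∣ ⌊ y ⌋ ∣)

  -- The integers under ∣_∣ here and in τ are nonnegative when x ≥ 1 and l ≥ 2.
  t : (x : ℝ) (l : ℕ) → ℕ
  t x l = ∣ ⌊ logBase l x ⌋ ∣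

  τ : (x : ℝ) (j l : ℕ) → ℕ
  τ x j l = (t x l ℕ.∸ j) ℕ.⊓
    ∣ ⌈ (frac (logBase l x) * log (fromℕ l) + fromℕ j * log (fromℕ l))
        ÷ (log (fromℕ (suc l)) - log (fromℕ l)) ⌉ ∣

  -- x enters xᵢ, κ and v only through φ = {log_l x}; besides φ, l and j, the
  -- coefficients of P depend only on its degree bound τ.
  module _ (φ : ℝ) (l j : ℕ) where

    xᵢ : ℕ → ℝ
    xᵢ i = (l ^ʳ φ) * fromℕ (l ℕ.^ (i ℕ.+ j))

    κ : ℕ → ℕ
    κ i = F i (xᵢ i) (suc l)

    v : (τ m : ℕ) → ℚ
    v τ m = ∑[ m ⋯ τ ] λ i → fromℕ-ℚ (κ i) ℚ.* (s i m ℚ./ 1) ℚ.* 1/ i !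

    P : (τ : ℕ) → Polynomial τ
    P τ m = v τ (toℕ m)

{-# OPTIONS --safe #-}
module Submission where

-- Put k = t - j.  Sort the k-tuples of integers ≥ l with product at most x by the
-- number k - i of entries equal to l.  These entries can be placed in (k choose i)
-- ways; the other i entries are ≥ l + 1 and have product at most
-- x / l ^ (k - i) = xᵢ, because x = l ^ {log_l x} · l ^ t and t - (k - i) = i + j.
-- Hence
--
--   F k x l = ∑ (i ≤ k) (k choose i) κ i.
--
-- An i-tuple of integers ≥ l + 1 has product at least (l + 1) ^ i, and taking
-- logarithms shows that (l + 1) ^ i ≤ xᵢ forces
-- i ≤ ({log_l x} log l + j log l) / (log (l + 1) - log l).  So κ i = 0 for
-- τ < i ≤ k, and the sum may stop at τ.  Finally, the Stirling numbers are the
-- coefficients of the falling factorials, and expanding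
-- (k choose i) = ∑ (m ≤ i) s i m k ^ m / i! and exchanging the summations turns
-- the truncated sum into the value of the polynomial at k.
--
-- The expansion and truncation of the counting function, given the needed relations
-- among the integers ⌊ x ⌋, ⌊ xᵢ ⌋ and powers of l and l + 1, are in count-binomial,
-- which rests on S-binomial.  Those relations come from x≈l^*xᵢ and ⌊xᵢ⌋<[l+1]^i,
-- and eval-coeff evaluates the polynomial.

open import Defs
open import Data.Fin.Base as Fin using (Fin; toℕ)
open import Data.Fin.Properties using (toℕ<n)
open import Data.Integer.Base using (∣_∣)
open import Data.Nat.Base as ℕ using (ℕ; zero; suc; _∸_)
open import Data.Nat.Combinatorics using (_C_; nCk+nC[k+1]≡[n+1]C[k+1]; k>n⇒nCk≡0)
import Data.Nat.ListAction as List
import Data.Nat.Properties as ℕ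
open import Data.Rational.Base using (ℚ)
open import Data.Product.Base using (proj₁)
open import Function.Base using (_∘_)
import Relation.Binary.PropositionalEquality as ≡
open import Relation.Binary.PropositionalEquality.Core using (_≡_)
open import Relation.Nullary.Negation using (¬_; contradiction)

-- Sums over tuples of integers

module Tuples where
  open import Data.Nat.Base hiding (ℕ; zero; suc; _∸_)
  open import Data.Nat.Properties
  open import Algebra.Properties.CommutativeSemigroup *-commutativeSemigroup
    using (x∙yz≈y∙xz)
  open import Algebra.Properties.Semiring.Sum +-*-semiring
  open import Data.Bool.Base using (true; false; if_then_else_; _∧_)
  open import Data.List.Base
    using ([]; _∷_; _++_; filter; length; map; applyUpTo; upTo; cartesianProductWith)
  open import Data.List.Properties using (map-++; map-∘; map-cong; map-upTo)
  open import Data.Nat.ListAction.Properties using (sum-++)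
  open import Data.Vec.Base as Vec using (Vec; _∷_)
  open import Data.Vec.Relation.Unary.All using (all?)
  open import Relation.Nullary.Decidable.Core using (Dec; does; yes; no; _×-dec_)
  open import Relation.Unary using (Decidable)
  open ≡ using (_≗_; refl; sym; trans; cong; cong₂; module ≡-Reasoning)
  open ≡-Reasoning

  -- The Iverson bracket.
  𝟙 : ∀ {p} {P : Set p} → Dec P → ℕ
  𝟙 P? = if does P? then 1 else 0

  sum-zero : ∀ n {g : Fin n → ℕ} → (∀ i → g i ≡ 0) → sum g ≡ 0
  sum-zero n g≡0 = trans (sum-cong-≗ g≡0) (sum-replicate-zero n)

  sum-extend : ∀ {m n} (g : ℕ → ℕ) → m ≤ n → (∀ i → m ≤ i → i < n → g i ≡ 0) →
               ∑[ i < n ] g (toℕ i) ≡ ∑[ i < m ] g (toℕ i)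
  sum-extend {n = n} g z≤n g≡0 = sum-zero n λ i → g≡0 (toℕ i) z≤n (toℕ<n i)
  sum-extend g (s≤s m≤n) g≡0 =
    cong (g 0 +_) (sum-extend (g ∘ suc) m≤n λ i m≤i i<n → g≡0 (suc i) (s≤s m≤i) (s≤s i<n))

  sum-select : ∀ {m n} (g : ℕ → ℕ) → m < n → ∑[ i < n ] (𝟙 (m ≟ toℕ i) * g (toℕ i)) ≡ g m
  sum-select {zero} {suc n} g _ =
    trans (cong₂ _+_ (*-identityˡ (g 0)) (sum-zero n λ _ → refl)) (+-identityʳ (g 0))
  sum-select {suc m} {suc n} g (s≤s m<n) = sum-select (g ∘ suc) m<n

  sum-𝟙≟ : ∀ m n → ∑[ i < n ] 𝟙 (m ≟ toℕ i) ≡ 𝟙 (m <? n)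
  sum-𝟙≟ m       zero    = refl
  sum-𝟙≟ zero    (suc n) = cong suc (sum-zero n λ _ → refl)
  sum-𝟙≟ (suc m) (suc n) = sum-𝟙≟ m n

  sum-applyUpTo : ∀ (g : ℕ → ℕ) n → List.sum (applyUpTo g n) ≡ ∑[ i < n ] g (toℕ i)
  sum-applyUpTo g zero    = refl
  sum-applyUpTo g (suc n) = cong (g 0 +_) (sum-applyUpTo (g ∘ suc) n)

  𝟙-≤-split : ∀ m n → 𝟙 (m ≤? n) ≡ 𝟙 (m ≟ n) + 𝟙 (suc m ≤? n)
  𝟙-≤-split zero          zero    = refl
  𝟙-≤-split zero          (suc n) = refl
  𝟙-≤-split (suc m)       zero    = refl
  𝟙-≤-split (suc zero)    (suc n) = 𝟙-≤-split zero n
  𝟙-≤-split (suc (suc m)) (suc n) = 𝟙-≤-split (suc m) n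

  -- Pascal's rule, summed against an arbitrary sequence.
  binomial-step : ∀ k (A : ℕ → ℕ) →
    ∑[ i ≤ suc k ] ((suc k C toℕ i) * A (toℕ i)) ≡
    ∑[ i ≤ k ] ((k C toℕ i) * A (toℕ i)) + ∑[ i ≤ k ] ((k C toℕ i) * A (suc (toℕ i)))
  binomial-step k A = begin
    A₀ + ∑[ i ≤ k ] ((suc k C suc (toℕ i)) * A⁺ i)
      ≡⟨ cong (A₀ +_) (sum-cong-≗ {suc k} λ i → trans
           (cong (_* A⁺ i) (sym (trans (+-comm (k C suc (toℕ i)) _)
             (nCk+nC[k+1]≡[n+1]C[k+1] k (toℕ i)))))
           (*-distribʳ-+ (A⁺ i) (k C suc (toℕ i)) (k C toℕ i))) ⟩
    A₀ + ∑[ i ≤ k ] ((k C suc (toℕ i)) * A⁺ i + (k C toℕ i) * A⁺ i)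
      ≡⟨ cong (A₀ +_) (∑-distrib-+ {suc k}
           (λ i → (k C suc (toℕ i)) * A⁺ i) (λ i → (k C toℕ i) * A⁺ i)) ⟩
    A₀ + (∑[ i ≤ k ] ((k C suc (toℕ i)) * A⁺ i) + rest)
      ≡⟨ +-assoc A₀ _ rest ⟨
    ∑[ i ≤ suc k ] ((k C toℕ i) * A (toℕ i)) + rest
      ≡⟨ cong (_+ rest) (sum-extend (λ i → (k C i) * A i) (n≤1+n (suc k))
           λ i k<i _ → cong (_* A i) (k>n⇒nCk≡0 k<i)) ⟩
    ∑[ i ≤ k ] ((k C toℕ i) * A (toℕ i)) + rest ∎
    where
    A⁺ : Fin (suc k) → ℕ
    A⁺ i = A (suc (toℕ i))
    A₀ = (k C 0) * A 0
    rest = ∑[ i ≤ k ] ((k C toℕ i) * A⁺ i)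

  𝟙*-cong : ∀ {p} {P : Set p} (P? : Dec P) {m n} → (P → m ≡ n) → 𝟙 P? * m ≡ 𝟙 P? * n
  𝟙*-cong (yes p) m≡n = cong (1 *_) (m≡n p)
  𝟙*-cong (no _)  _   = refl

  𝟙*-zero : ∀ {p} {P : Set p} (P? : Dec P) {m} → (P → m ≡ 0) → 𝟙 P? * m ≡ 0
  𝟙*-zero P? m≡0 = trans (𝟙*-cong P? m≡0) (*-zeroʳ (𝟙 P?))

  -- The sum of φ (i₁ ⋯ iₖ) over all k-tuples of integers with l ≤ iⱼ < B.  The
  -- weight φ is arbitrary so that peeling off an entry a is again such a sum, with
  -- weight p ↦ φ (a p).
  S : (B l k : ℕ) → (ℕ → ℕ) → ℕ
  S B l zero    φ = φ 1
  S B l (suc k) φ = ∑[ a < B ] (𝟙 (l ≤? toℕ a) * S B l k (λ p → φ (toℕ a * p)))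

  module _ {B l : ℕ} where

    S-cong : ∀ k {φ ψ : ℕ → ℕ} → φ ≗ ψ → S B l k φ ≡ S B l k ψ
    S-cong zero    φ≗ψ = φ≗ψ 1
    S-cong (suc k) φ≗ψ = sum-cong-≗ {B} λ a →
      cong (𝟙 (l ≤? toℕ a) *_) (S-cong k λ p → φ≗ψ (toℕ a * p))

    S-sum : ∀ k n (φ : Fin n → ℕ → ℕ) →
            S B l k (λ p → ∑[ i < n ] φ i p) ≡ ∑[ i < n ] S B l k (φ i)
    S-sum zero    n φ = refl
    S-sum (suc k) n φ = trans
      (sum-cong-≗ {B} λ a → trans
        (cong (𝟙 (l ≤? toℕ a) *_) (S-sum k n λ i p → φ i (toℕ a * p)))
        (*-distribˡ-sum {n} (𝟙 (l ≤? toℕ a)) _))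
      (∑-comm {B} {n} _)

    S-vanish : ∀ k {φ : ℕ → ℕ} → (∀ q → l ^ k ≤ q → φ q ≡ 0) → S B l k φ ≡ 0
    S-vanish zero    φ≡0 = φ≡0 1 ≤-refl
    S-vanish (suc k) φ≡0 = sum-zero B λ a → 𝟙*-zero (l ≤? toℕ a) λ l≤a →
      S-vanish k λ q lᵏ≤q → φ≡0 (toℕ a * q) (*-mono-≤ l≤a lᵏ≤q)

  -- The upper bound B on the entries is immaterial once φ is supported in 1, …, B - 1.
  S-bound : ∀ {B B′ l} → 1 ≤ l → B ≤ B′ → ∀ k {φ : ℕ → ℕ} →
            φ 0 ≡ 0 → (∀ q → B ≤ q → φ q ≡ 0) → S B′ l k φ ≡ S B l k φ
  S-bound              1≤l B≤B′ zero        φ0≡0 φ≡0 = refl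
  S-bound {B} {B′} {l} 1≤l B≤B′ (suc k) {φ} φ0≡0 φ≡0 = trans
    (sum-extend term B≤B′ λ a B≤a _ → 𝟙*-zero (l ≤? a) λ l≤a →
      S-vanish k λ q lᵏ≤q → φ≡0 (a * q)
        (≤-trans B≤a (m≤m*n a q {{>-nonZero (≤-trans (m^n>0 l k) lᵏ≤q)}})))
    (sum-cong-≗ {B} λ a → 𝟙*-cong (l ≤? toℕ a) λ l≤a →
      S-bound 1≤l B≤B′ k (trans (cong φ (*-zeroʳ (toℕ a))) φ0≡0) λ q B≤q →
        φ≡0 (toℕ a * q) (≤-trans B≤q (m≤n*m q (toℕ a) {{>-nonZero (≤-trans 1≤l l≤a)}})))
    where
    instance _ = >-nonZero 1≤l
    term : ℕ → ℕ
    term a = 𝟙 (l ≤? a) * S B′ l k (λ p → φ (a * p))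

  -- Classifying the k-tuples by the number k - i of entries equal to l: these can
  -- be placed in (k choose i) ways, and the others form an i-tuple of entries
  -- ≥ l + 1.  The induction peels off the first entry.
  S-binomial : ∀ {B l} → l < B → ∀ k (φ : ℕ → ℕ) →
    S B l k φ ≡ ∑[ i ≤ k ] ((k C toℕ i) * S B (suc l) (toℕ i) (λ q → φ (l ^ (k ∸ toℕ i) * q)))
  S-binomial l<B zero φ = sym (trans (+-identityʳ (1 * φ 1)) (*-identityˡ (φ 1)))
  S-binomial {B} {l} l<B (suc k) φ = begin
    ∑[ a < B ] (𝟙 (l ≤? toℕ a) * S B l k φ⟨ toℕ a ⟩)
      ≡⟨ sum-cong-≗ {B} (λ a → trans
           (cong (_* S B l k φ⟨ toℕ a ⟩) (𝟙-≤-split l (toℕ a)))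
           (*-distribʳ-+ (S B l k φ⟨ toℕ a ⟩) (𝟙 (l ≟ toℕ a)) _)) ⟩
    ∑[ a < B ] (𝟙 (l ≟ toℕ a) * S B l k φ⟨ toℕ a ⟩ + 𝟙 (suc l ≤? toℕ a) * S B l k φ⟨ toℕ a ⟩)
      ≡⟨ ∑-distrib-+ {B} _ _ ⟩
    ∑[ a < B ] (𝟙 (l ≟ toℕ a) * S B l k φ⟨ toℕ a ⟩) +
    ∑[ a < B ] (𝟙 (suc l ≤? toℕ a) * S B l k φ⟨ toℕ a ⟩)
      ≡⟨ cong₂ _+_ (trans (sum-select (λ a → S B l k φ⟨ a ⟩) l<B) first) others ⟩
    ∑[ i ≤ k ] ((k C toℕ i) * A (toℕ i)) + ∑[ i ≤ k ] ((k C toℕ i) * A (suc (toℕ i)))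
      ≡⟨ binomial-step k A ⟨
    ∑[ i ≤ suc k ] ((suc k C toℕ i) * A (toℕ i)) ∎
    where
    φ⟨_⟩ : ℕ → ℕ → ℕ
    φ⟨ a ⟩ p = φ (a * p)

    A : ℕ → ℕ
    A i = S B (suc l) i φ⟨ l ^ (suc k ∸ i) ⟩

    first : S B l k φ⟨ l ⟩ ≡ ∑[ i ≤ k ] ((k C toℕ i) * A (toℕ i))
    first = trans (S-binomial l<B k φ⟨ l ⟩) (sum-cong-≗ {suc k} λ i →
      cong ((k C toℕ i) *_) (S-cong {B} {suc l} (toℕ i) λ q → cong φ (trans
        (sym (*-assoc l (l ^ (k ∸ toℕ i)) q))
        (cong (λ e → l ^ e * q) (sym (+-∸-assoc 1 (≤-pred (toℕ<n i))))))))

    T : ℕ → ℕ → ℕ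
    T a i = S B (suc l) i (λ q → φ (a * (l ^ (k ∸ i) * q)))

    others : ∑[ a < B ] (𝟙 (suc l ≤? toℕ a) * S B l k φ⟨ toℕ a ⟩) ≡
             ∑[ i ≤ k ] ((k C toℕ i) * A (suc (toℕ i)))
    others = begin
      ∑[ a < B ] (𝟙 (suc l ≤? toℕ a) * S B l k φ⟨ toℕ a ⟩)
        ≡⟨ sum-cong-≗ {B} (λ a → trans
             (cong (𝟙 (suc l ≤? toℕ a) *_) (S-binomial l<B k φ⟨ toℕ a ⟩))
             (*-distribˡ-sum {suc k} (𝟙 (suc l ≤? toℕ a))
               (λ i → (k C toℕ i) * T (toℕ a) (toℕ i)))) ⟩
      ∑[ a < B ] ∑[ i ≤ k ] (𝟙 (suc l ≤? toℕ a) * ((k C toℕ i) * T (toℕ a) (toℕ i)))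
        ≡⟨ ∑-comm {B} {suc k} (λ a i → 𝟙 (suc l ≤? toℕ a) * ((k C toℕ i) * T (toℕ a) (toℕ i))) ⟩
      ∑[ i ≤ k ] ∑[ a < B ] (𝟙 (suc l ≤? toℕ a) * ((k C toℕ i) * T (toℕ a) (toℕ i)))
        ≡⟨ sum-cong-≗ {suc k} (λ i → trans
             (sum-cong-≗ {B} λ a → trans (x∙yz≈y∙xz (𝟙 (suc l ≤? toℕ a)) (k C toℕ i) _)
               (cong (λ z → (k C toℕ i) * (𝟙 (suc l ≤? toℕ a) * z))
                 (S-cong {B} {suc l} (toℕ i) λ q → cong φ (x∙yz≈y∙xz (toℕ a) (l ^ (k ∸ toℕ i)) q))))
             (sym (*-distribˡ-sum {B} (k C toℕ i)
               (λ a → 𝟙 (suc l ≤? toℕ a) *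
                 S B (suc l) (toℕ i) (λ p → φ⟨ l ^ (k ∸ toℕ i) ⟩ (toℕ a * p)))))) ⟩
      ∑[ i ≤ k ] ((k C toℕ i) * A (suc (toℕ i))) ∎

  length-filter≡sum : ∀ {a p} {A : Set a} {P : A → Set p} (P? : Decidable P) xs →
                      length (filter P? xs) ≡ List.sum (map (λ x → 𝟙 (P? x)) xs)
  length-filter≡sum P? []       = refl
  length-filter≡sum P? (x ∷ xs) with does (P? x)
  ... | true  = cong suc (length-filter≡sum P? xs)
  ... | false = length-filter≡sum P? xs

  sum-map-* : ∀ {a} {A : Set a} c (h : A → ℕ) xs →
              List.sum (map (λ x → c * h x) xs) ≡ c * List.sum (map h xs)
  sum-map-* c h []       = sym (*-zeroʳ c)
  sum-map-* c h (x ∷ xs) =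
    trans (cong (c * h x +_) (sum-map-* c h xs)) (sym (*-distribˡ-+ c (h x) _))

  sum-cartesianProductWith : ∀ {a} {A B C : Set a} (g : A → B → C) (h : C → ℕ) xs ys →
    List.sum (map h (cartesianProductWith g xs ys)) ≡
    List.sum (map (λ x → List.sum (map (λ y → h (g x y)) ys)) xs)
  sum-cartesianProductWith g h []       ys = refl
  sum-cartesianProductWith g h (x ∷ xs) ys = begin
    List.sum (map h (map (g x) ys ++ cartesianProductWith g xs ys))
      ≡⟨ cong List.sum (map-++ h (map (g x) ys) _) ⟩
    List.sum (map h (map (g x) ys) ++ map h (cartesianProductWith g xs ys))
      ≡⟨ sum-++ (map h (map (g x) ys)) _ ⟩
    List.sum (map h (map (g x) ys)) + List.sum (map h (cartesianProductWith g xs ys))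
      ≡⟨ cong₂ _+_ (cong List.sum (sym (map-∘ ys))) (sum-cartesianProductWith g h xs ys) ⟩
    List.sum (map (λ x → List.sum (map (λ y → h (g x y)) ys)) (x ∷ xs)) ∎

  -- The decision procedure in the definition of f, on a tuple with one more entry,
  -- computes to the Boolean on the left.
  𝟙-∧ : ∀ b c d →
    (if (b ∧ c) ∧ d then 1 else 0) ≡ (if b then 1 else 0) * (if c ∧ d then 1 else 0)
  𝟙-∧ true  c d = sym (*-identityˡ _)
  𝟙-∧ false c d = refl

  -- The enumeration by which f is defined, for an arbitrary condition Q on the product.
  filter≡S : ∀ B l k {p} {Q : ℕ → Set p} (Q? : Decidable Q) →
    List.sum (map (λ is → 𝟙 (all? (l ≤?_) is ×-dec Q? (Vec.foldr′ _*_ 1 is)))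
                  (tuples k (upTo B)))
    ≡ S B l k (λ p → 𝟙 (Q? p))
  filter≡S B l zero    Q? = +-identityʳ _
  filter≡S B l (suc k) Q? = begin
    List.sum (map h (cartesianProductWith _∷_ (upTo B) ts))
      ≡⟨ sum-cartesianProductWith _∷_ h (upTo B) ts ⟩
    List.sum (map (λ a → List.sum (map (λ is → h (a ∷ is)) ts)) (upTo B))
      ≡⟨ cong List.sum (map-cong (λ a → trans
           (cong List.sum (map-cong (λ is → 𝟙-∧ (does (l ≤? a)) (does (all? (l ≤?_) is)) _) ts))
           (trans (sum-map-* (𝟙 (l ≤? a)) _ ts)
             (cong (𝟙 (l ≤? a) *_) (filter≡S B l k (λ p → Q? (a * p))))))
           (upTo B)) ⟩
    List.sum (map term (upTo B))
      ≡⟨ cong List.sum (map-upTo term B) ⟩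
    List.sum (applyUpTo term B)
      ≡⟨ sum-applyUpTo term B ⟩
    S B l (suc k) (λ p → 𝟙 (Q? p)) ∎
    where
    ts = tuples k (upTo B)
    h : Vec ℕ (suc k) → ℕ
    h is = 𝟙 (all? (l ≤?_) is ×-dec Q? (Vec.foldr′ _*_ 1 is))
    term : ℕ → ℕ
    term a = 𝟙 (l ≤? a) * S B l k (λ p → 𝟙 (Q? (a * p)))

  f≡S : ∀ k n l → f k n l ≡ S (suc n) l k (λ p → 𝟙 (p ≟ n))
  f≡S k n l = trans (length-filter≡sum _ (tuples k (upTo (suc n)))) (filter≡S (suc n) l k (_≟ n))

  -- The characteristic function of {1, …, N}.
  χ : ℕ → ℕ → ℕ
  χ N zero    = 0
  χ N (suc p) = 𝟙 (p <? N)

  𝟙-no : ∀ {p} {P : Set p} (P? : Dec P) → ¬ P → 𝟙 P? ≡ 0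
  𝟙-no (yes p) ¬p = contradiction p ¬p
  𝟙-no (no _)  _  = refl

  𝟙-⇔ : ∀ {p q} {P : Set p} {Q : Set q} (P? : Dec P) (Q? : Dec Q) →
        (P → Q) → (Q → P) → 𝟙 P? ≡ 𝟙 Q?
  𝟙-⇔ (yes p) (yes q) _ _ = refl
  𝟙-⇔ (yes p) (no ¬q) g _ = contradiction (g p) ¬q
  𝟙-⇔ (no ¬p) (yes q) _ h = contradiction (h q) ¬p
  𝟙-⇔ (no _)  (no _)  _ _ = refl

  χ-above : ∀ {N} q → N < q → χ N q ≡ 0
  χ-above (suc q) (s≤s N≤q) = 𝟙-no (q <? _) (≤⇒≯ N≤q)

  -- The number of k-tuples of integers ≥ l with product at most N; F k y l is
  -- definitionally the case N = ∣ ⌊ y ⌋ ∣.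
  count : (k N l : ℕ) → ℕ
  count k N l = List.sum (applyUpTo (λ n → f k (suc n) l) N)

  -- While f bounds the entries of the tuples with product n by n, a single bound B
  -- serves for all products at once.
  count≡S : ∀ {N B l} k → 1 ≤ l → N < B → count k N l ≡ S B l k (χ N)
  count≡S {N} {B} {l} k 1≤l N<B = begin
    count k N l
      ≡⟨ sum-applyUpTo _ N ⟩
    ∑[ n < N ] f k (suc (toℕ n)) l
      ≡⟨ sum-cong-≗ {N} (λ n → trans (f≡S k (suc (toℕ n)) l)
           (sym (S-bound 1≤l (≤-trans (s≤s (toℕ<n n)) N<B) k refl
              λ q n<q → 𝟙-no (q ≟ suc (toℕ n)) (>⇒≢ n<q)))) ⟩
    ∑[ n < N ] S B l k (λ p → 𝟙 (p ≟ suc (toℕ n)))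
      ≡⟨ S-sum k N _ ⟨
    S B l k (λ p → ∑[ n < N ] 𝟙 (p ≟ suc (toℕ n)))
      ≡⟨ S-cong k (λ { zero → sum-zero N λ _ → refl ; (suc p) → sum-𝟙≟ p N }) ⟩
    S B l k (χ N) ∎

  χ-scale : ∀ {M N N′} → 1 ≤ M → (∀ q → M * q ≤ N → q ≤ N′) → (∀ q → q ≤ N′ → M * q ≤ N) →
            ∀ q → χ N (M * q) ≡ χ N′ q
  χ-scale {M} {N} {N′} 1≤M to from zero = cong (χ N) (*-zeroʳ M)
  χ-scale {suc M} {N} {N′} 1≤M to from (suc q) = 𝟙-⇔ (_ <? N) (q <? N′) (to (suc q)) (from (suc q))

  -- The binomial expansion of the counting function.  The number Nᵢ i plays the
  -- role of ⌊ N / l ^ (k - i) ⌋, specified by its adjunction with multiplication;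
  -- an i-tuple of entries ≥ l + 1 has product ≥ (l + 1) ^ i, so that the terms with
  -- Nᵢ i < (l + 1) ^ i drop out.
  count-binomial : ∀ {l k τ N} (Nᵢ : ℕ → ℕ) → 1 ≤ l → τ ≤ k →
    (∀ i → i ≤ k → ∀ q → l ^ (k ∸ i) * q ≤ N → q ≤ Nᵢ i) →
    (∀ i → i ≤ k → ∀ q → q ≤ Nᵢ i → l ^ (k ∸ i) * q ≤ N) →
    (∀ i → τ < i → i ≤ k → Nᵢ i < suc l ^ i) →
    count k N l ≡ ∑[ i ≤ τ ] ((k C toℕ i) * count (toℕ i) (Nᵢ (toℕ i)) (suc l))
  count-binomial {l} {k} {τ} {N} Nᵢ 1≤l τ≤k to from small = begin
    count k N l
      ≡⟨ count≡S k 1≤l (s≤s (m≤m+n N l)) ⟩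
    S B l k (χ N)
      ≡⟨ S-binomial (s≤s (m≤n+m l N)) k (χ N) ⟩
    ∑[ i ≤ k ] ((k C toℕ i) * S B (suc l) (toℕ i) (λ q → χ N (l ^ (k ∸ toℕ i) * q)))
      ≡⟨ sum-cong-≗ {suc k} (λ i → cong ((k C toℕ i) *_) (term (toℕ i) (≤-pred (toℕ<n i)))) ⟩
    ∑[ i ≤ k ] ((k C toℕ i) * κ (toℕ i))
      ≡⟨ sum-extend (λ i → (k C i) * κ i) (s≤s τ≤k) (λ i τ<i i≤k →
           trans (cong ((k C i) *_) (κ-zero i τ<i (≤-pred i≤k))) (*-zeroʳ (k C i))) ⟩
    ∑[ i ≤ τ ] ((k C toℕ i) * κ (toℕ i)) ∎
    where
    instance _ = >-nonZero 1≤l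

    -- Large enough to exceed l, N and every Nᵢ i with i ≤ k.
    B = suc (N + l)

    κ : ℕ → ℕ
    κ i = count i (Nᵢ i) (suc l)

    Nᵢ<B : ∀ i → i ≤ k → Nᵢ i < B
    Nᵢ<B i i≤k = s≤s (≤-trans (m≤n*m (Nᵢ i) (l ^ (k ∸ i)) {{m^n≢0 l (k ∸ i)}})
      (≤-trans (from i i≤k (Nᵢ i) ≤-refl) (m≤m+n N l)))

    κ≡S : ∀ i → i ≤ k → κ i ≡ S B (suc l) i (χ (Nᵢ i))
    κ≡S i i≤k = count≡S i (s≤s z≤n) (Nᵢ<B i i≤k)

    term : ∀ i → i ≤ k → S B (suc l) i (λ q → χ N (l ^ (k ∸ i) * q)) ≡ κ i
    term i i≤k = trans
      (S-cong {B} {suc l} i (χ-scale (m^n>0 l (k ∸ i)) (to i i≤k) (from i i≤k)))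
      (sym (κ≡S i i≤k))

    κ-zero : ∀ i → τ < i → i ≤ k → κ i ≡ 0
    κ-zero i τ<i i≤k = trans (κ≡S i i≤k)
      (S-vanish i λ q [l+1]ⁱ≤q → χ-above q (≤-trans (small i τ<i i≤k) [l+1]ⁱ≤q))

-- Binomial coefficients as polynomials

module Polynomials where
  import Data.Integer.Properties as ℤ
  open import Data.Nat.Base as ℕ using (z≤n; s≤s; _!; NonZero)
  open import Data.Rational.Base as ℚ using (0ℚ; 1ℚ; _+_; _*_; _-_; -_; _/_; toℚᵘ)
  open import Data.Rational.Properties
  import Data.Nat.Properties as ℕ
  import Data.Rational.Unnormalised.Base as ℚᵘ
  import Data.Rational.Unnormalised.Properties as ℚᵘ
  open import Algebra.Bundles using (CommutativeRing)
  open import Algebra.Definitions.RawSemiring ℚ.+-*-rawSemiring using (_^_)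
  import Algebra.Properties.Semiring.Sum ℕ.+-*-semiring as ℕΣ
  open import Algebra.Properties.Semiring.Sum (CommutativeRing.semiring +-*-commutativeRing)
  open import Data.List.Base as List using (applyUpTo)
  open import Data.Rational.Solver using (module +-*-Solver)
  open +-*-Solver using (solve; _:+_; _:*_; _:-_; :-_; _:=_)
  open import Data.Integer.Base as ℤ using (ℤ; +_)
  open ≡ using (refl; sym; trans; cong; cong₂; module ≡-Reasoning)
  open ≡-Reasoning

  -- The embedding of ℤ in ℚ, a ring homomorphism; fromℕ-ℚ n is ι (+ n).
  ι : ℤ → ℚ
  ι z = z / 1

  toℚᵘ-ι : ∀ z → toℚᵘ (ι z) ℚᵘ.≃ ℚᵘ.mkℚᵘ z 0
  toℚᵘ-ι z = toℚᵘ-fromℚᵘ (ℚᵘ.mkℚᵘ z 0)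

  ι-+ : ∀ y z → ι (y ℤ.+ z) ≡ ι y + ι z
  ι-+ y z = toℚᵘ-injective (ℚᵘ.≃-trans (toℚᵘ-ι (y ℤ.+ z)) (ℚᵘ.≃-trans
    (ℚᵘ.*≡* (cong (ℤ._* + 1) (sym (cong₂ ℤ._+_ (ℤ.*-identityʳ y) (ℤ.*-identityʳ z)))))
    (ℚᵘ.≃-sym (ℚᵘ.≃-trans (toℚᵘ-homo-+ (ι y) (ι z)) (ℚᵘ.+-cong (toℚᵘ-ι y) (toℚᵘ-ι z))))))

  ι-* : ∀ y z → ι (y ℤ.* z) ≡ ι y * ι z
  ι-* y z = toℚᵘ-injective (ℚᵘ.≃-trans (toℚᵘ-ι (y ℤ.* z)) (ℚᵘ.≃-sym
    (ℚᵘ.≃-trans (toℚᵘ-homo-* (ι y) (ι z)) (ℚᵘ.*-cong (toℚᵘ-ι y) (toℚᵘ-ι z)))))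

  ι-neg : ∀ z → ι (ℤ.- z) ≡ - ι z
  ι-neg z = toℚᵘ-injective (ℚᵘ.≃-trans (toℚᵘ-ι (ℤ.- z)) (ℚᵘ.≃-sym
    (ℚᵘ.≃-trans (toℚᵘ-homo‿- (ι z)) (ℚᵘ.-‿cong (toℚᵘ-ι z)))))

  ι-sum : ∀ n (g : Fin n → ℕ) → fromℕ-ℚ (ℕΣ.sum g) ≡ ∑[ i < n ] fromℕ-ℚ (g i)
  ι-sum zero    g = refl
  ι-sum (suc n) g = trans (ι-+ (+ g Fin.zero) (+ ℕΣ.sum (g ∘ Fin.suc)))
    (cong (λ q → fromℕ-ℚ (g Fin.zero) + q) (ι-sum n (g ∘ Fin.suc)))

  1/n*n≡1 : ∀ n .{{_ : NonZero n}} → (+ 1 / n) * fromℕ-ℚ n ≡ 1ℚ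
  1/n*n≡1 (suc n) = toℚᵘ-injective (ℚᵘ.≃-trans (toℚᵘ-homo-* (+ 1 / suc n) (ι (+ suc n)))
    (ℚᵘ.≃-trans (ℚᵘ.*-cong (toℚᵘ-fromℚᵘ (ℚᵘ.mkℚᵘ (+ 1) n)) (toℚᵘ-ι (+ suc n)))
     (ℚᵘ.*≡* (trans (ℤ.*-identityʳ _) (trans (ℤ.*-identityˡ _)
       (sym (trans (ℤ.*-identityˡ _) (ℤ.*-identityʳ (+ suc n)))))))))

  -- The value X (X - 1) ⋯ (X - i + 1) of the i-th falling factorial at X.
  falling : ℚ → ℕ → ℚ
  falling X zero    = 1ℚ
  falling X (suc i) = (X - fromℕ-ℚ i) * falling X i

  sum-zero : ∀ n {g : Fin n → ℚ} → (∀ i → g i ≡ 0ℚ) → sum g ≡ 0ℚ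
  sum-zero n g≡0 = trans (sum-cong-≗ g≡0) (sum-replicate-zero n)

  s-above : ∀ {i m} → i ℕ.< m → s i m ≡ + 0
  s-above {zero}  {suc m} _ = refl
  s-above {suc i} {suc m} (s≤s i<m) = trans
    (cong₂ (λ y z → y ℤ.- + i ℤ.* z) (s-above i<m) (s-above (ℕ.m<n⇒m<1+n i<m)))
    (trans (ℤ.+-identityˡ _) (cong ℤ.-_ (ℤ.*-zeroʳ (+ i))))

  -- The Stirling numbers s i m are the coefficients of the i-th falling factorial.
  -- The summation bound n ≥ i is free: the recursion for i + 1 uses the sum for i
  -- both up to n and up to n + 1.
  sum-s : ∀ X i n → i ℕ.≤ n → ∑[ m ≤ n ] (ι (s i (toℕ m)) * X ^ toℕ m) ≡ falling X i
  sum-s X zero n _ = trans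
    (cong₂ _+_ (*-identityˡ 1ℚ) (sum-zero n λ m → *-zeroˡ (X ^ suc (toℕ m)))) (+-identityʳ 1ℚ)
  sum-s X (suc i) (suc n) (s≤s i≤n) = begin
    ι (ℤ.- (+ i ℤ.* s i 0)) * 1ℚ + ∑[ m ≤ n ] (ι (s (suc i) (suc (toℕ m))) * (X * X ^ toℕ m))
      ≡⟨ cong₂ _+_ (cong (_* 1ℚ) (trans (ι-neg (+ i ℤ.* s i 0)) (cong -_ (ι-* (+ i) (s i 0)))))
           (trans (sum-cong-≗ {suc n} step) (∑-distrib-+ {suc n} (λ m → X * a m) (λ m → - I * b m))) ⟩
    (- (I * ι (s i 0))) * 1ℚ + (∑[ m ≤ n ] (X * a m) + ∑[ m ≤ n ] (- I * b m))
      ≡⟨ cong (λ z → (- (I * ι (s i 0))) * 1ℚ + z) (cong₂ _+_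
           (trans (sym (*-distribˡ-sum {suc n} X a)) (cong (X *_) (sum-s X i n i≤n)))
           (sym (*-distribˡ-sum {suc n} (- I) b))) ⟩
    (- (I * ι (s i 0))) * 1ℚ + (X * falling X i + - I * sum b)
      ≡⟨ solve 6 (λ I c o X d e →
             (:- (I :* c)) :* o :+ (X :* d :+ :- I :* e) := X :* d :- I :* (c :* o :+ e))
           refl I (ι (s i 0)) 1ℚ X (falling X i) (sum b) ⟩
    X * falling X i - I * (ι (s i 0) * 1ℚ + sum b)
      ≡⟨ cong (λ z → X * falling X i - I * z) (sum-s X i (suc n) (ℕ.m≤n⇒m≤1+n i≤n)) ⟩
    X * falling X i - I * falling X i
      ≡⟨ solve 3 (λ X I d → X :* d :- I :* d := (X :- I) :* d) refl X I (falling X i) ⟩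
    (X - I) * falling X i ∎
    where
    I = fromℕ-ℚ i
    a b : Fin (suc n) → ℚ
    a m = ι (s i (toℕ m)) * X ^ toℕ m
    b m = ι (s i (suc (toℕ m))) * (X * X ^ toℕ m)

    step : ∀ m → ι (s (suc i) (suc (toℕ m))) * (X * X ^ toℕ m) ≡ X * a m + - I * b m
    step m = trans
      (cong (_* (X * X ^ toℕ m)) (trans (ι-+ (s i (toℕ m)) _)
        (cong (λ z → ι (s i (toℕ m)) + z)
          (trans (ι-neg (+ i ℤ.* s i (suc (toℕ m)))) (cong -_ (ι-* (+ i) (s i (suc (toℕ m)))))))))
      (solve 5 (λ c X p I d →
          (c :+ :- (I :* d)) :* (X :* p) := X :* (c :* p) :+ :- I :* (d :* (X :* p)))
        refl (ι (s i (toℕ m))) X (X ^ toℕ m) I (ι (s i (suc (toℕ m)))))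

  fromℕ-ℚ-suc : ∀ n → fromℕ-ℚ (suc n) ≡ fromℕ-ℚ n + 1ℚ
  fromℕ-ℚ-suc n = trans (cong fromℕ-ℚ (ℕ.+-comm 1 n)) (ι-+ (+ n) (+ 1))

  falling-0 : ∀ i → falling 0ℚ (suc i) ≡ 0ℚ
  falling-0 zero    = refl
  falling-0 (suc i) = trans
    (cong ((0ℚ - fromℕ-ℚ (suc i)) *_) (falling-0 i)) (*-zeroʳ (0ℚ - fromℕ-ℚ (suc i)))

  -- (X + 1) X ⋯ (X - i + 1), with the first factor split off instead of the last.
  falling-suc : ∀ X i → falling (X + 1ℚ) (suc i) ≡ (X + 1ℚ) * falling X i
  falling-suc X zero    = cong (_* 1ℚ) (+-identityʳ (X + 1ℚ))
  falling-suc X (suc i) = begin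
    (X + 1ℚ - fromℕ-ℚ (suc i)) * falling (X + 1ℚ) (suc i)
      ≡⟨ cong₂ (λ y z → (X + 1ℚ - y) * z) (fromℕ-ℚ-suc i) (falling-suc X i) ⟩
    (X + 1ℚ - (fromℕ-ℚ i + 1ℚ)) * ((X + 1ℚ) * falling X i)
      ≡⟨ solve 4 (λ X o I d → (X :+ o :- (I :+ o)) :* ((X :+ o) :* d) := (X :+ o) :* ((X :- I) :* d))
           refl X 1ℚ (fromℕ-ℚ i) (falling X i) ⟩
    (X + 1ℚ) * falling X (suc i) ∎

  -- (n choose i) i! is the falling factorial, by Pascal's rule: for X = n,
  -- (i + 1) falling X i + falling X (i + 1) = (X + 1) falling X i.
  C*!≡falling : ∀ n i → fromℕ-ℚ (n C i) * fromℕ-ℚ (i !) ≡ falling (fromℕ-ℚ n) i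
  C*!≡falling n       zero    = refl
  C*!≡falling zero    (suc i) = trans (*-zeroˡ (fromℕ-ℚ (suc i !))) (sym (falling-0 i))
  C*!≡falling (suc n) (suc i) = begin
    fromℕ-ℚ (suc n C suc i) * fromℕ-ℚ (suc i !)
      ≡⟨ cong (_* fromℕ-ℚ (suc i !)) (trans
           (cong fromℕ-ℚ (sym (nCk+nC[k+1]≡[n+1]C[k+1] n i))) (ι-+ (+ (n C i)) (+ (n C suc i)))) ⟩
    (fromℕ-ℚ (n C i) + fromℕ-ℚ (n C suc i)) * fromℕ-ℚ (suc i !)
      ≡⟨ *-distribʳ-+ (fromℕ-ℚ (suc i !)) (fromℕ-ℚ (n C i)) (fromℕ-ℚ (n C suc i)) ⟩
    fromℕ-ℚ (n C i) * fromℕ-ℚ (suc i !) + fromℕ-ℚ (n C suc i) * fromℕ-ℚ (suc i !)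
      ≡⟨ cong₂ _+_
           (trans (cong (fromℕ-ℚ (n C i) *_) (trans (cong ι (ℤ.pos-* (suc i) (i !)))
             (trans (ι-* (+ suc i) (+ (i !))) (cong (_* fromℕ-ℚ (i !)) (fromℕ-ℚ-suc i)))))
           (trans (solve 4 (λ c I o x → c :* ((I :+ o) :* x) := (I :+ o) :* (c :* x)) refl
               (fromℕ-ℚ (n C i)) (fromℕ-ℚ i) 1ℚ (fromℕ-ℚ (i !)))
             (cong ((fromℕ-ℚ i + 1ℚ) *_) (C*!≡falling n i))))
           (C*!≡falling n (suc i)) ⟩
    (fromℕ-ℚ i + 1ℚ) * falling X i + (X - fromℕ-ℚ i) * falling X i
      ≡⟨ solve 4 (λ I o X d → (I :+ o) :* d :+ (X :- I) :* d := (X :+ o) :* d) refl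
           (fromℕ-ℚ i) 1ℚ X (falling X i) ⟩
    (X + 1ℚ) * falling X i
      ≡⟨ falling-suc X i ⟨
    falling (X + 1ℚ) (suc i)
      ≡⟨ cong (λ z → falling z (suc i)) (fromℕ-ℚ-suc n) ⟨
    falling (fromℕ-ℚ (suc n)) (suc i) ∎
    where X = fromℕ-ℚ n

  foldr-applyUpTo : ∀ (g : ℕ → ℚ) n → List.foldr _+_ 0ℚ (applyUpTo g n) ≡ ∑[ i < n ] g (toℕ i)
  foldr-applyUpTo g zero    = refl
  foldr-applyUpTo g (suc n) = cong (λ z → g 0 + z) (foldr-applyUpTo (g ∘ suc) n)

  sum-drop : ∀ (g : ℕ → ℚ) m n → (∀ i → i ℕ.< m → g i ≡ 0ℚ) →
             ∑[ i < n ℕ.∸ m ] g (m ℕ.+ toℕ i) ≡ ∑[ i < n ] g (toℕ i)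
  sum-drop g zero    n       g≡0 = refl
  sum-drop g (suc m) zero    g≡0 = refl
  sum-drop g (suc m) (suc n) g≡0 = begin
    ∑[ i < n ℕ.∸ m ] g (suc m ℕ.+ toℕ i)  ≡⟨ sum-drop (g ∘ suc) m n (λ i i<m → g≡0 (suc i) (s≤s i<m)) ⟩
    ∑[ i < n ] g (suc (toℕ i))            ≡⟨ +-identityˡ _ ⟨
    0ℚ + ∑[ i < n ] g (suc (toℕ i))       ≡⟨ cong (_+ (∑[ i < n ] g (suc (toℕ i)))) (g≡0 0 (s≤s z≤n)) ⟨
    ∑[ i < suc n ] g (toℕ i)              ∎

  -- The contribution of κ i (X choose i) to the coefficient of X ^ m.
  coeff : (κ : ℕ → ℕ) (i m : ℕ) → ℚ
  coeff κ i m = fromℕ-ℚ (κ i) * ι (s i m) * 1/ i !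

  -- Since s i m = 0 for i < m, the sum over m ≤ i ≤ τ may start at i = 0.
  sum-coeff : ∀ κ τ m → ∑[ m ⋯ τ ] (λ i → coeff κ i m) ≡ ∑[ i ≤ τ ] coeff κ (toℕ i) m
  sum-coeff κ τ m = trans (foldr-applyUpTo _ (suc τ ℕ.∸ m))
    (sum-drop (λ i → coeff κ i m) m (suc τ) λ i i<m →
    trans (cong (λ z → fromℕ-ℚ (κ i) * ι z * 1/ i !) (s-above i<m))
      (trans (cong (_* 1/ i !) (*-zeroʳ (fromℕ-ℚ (κ i)))) (*-zeroˡ (1/ i !))))

  -- The polynomial with coefficients ∑ (m ≤ i ≤ τ) coeff κ i m takes at a natural
  -- number k the value ∑ (i ≤ τ) (k choose i) κ i.
  eval-coeff : ∀ κ τ k →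
    eval {τ} (λ m → ∑[ toℕ m ⋯ τ ] (λ i → coeff κ i (toℕ m))) (fromℕ-ℚ k)
    ≡ fromℕ-ℚ (ℕΣ.sum {suc τ} (λ i → (k C toℕ i) ℕ.* κ (toℕ i)))
  eval-coeff κ τ k = begin
    ∑[ m ≤ τ ] (∑[ toℕ m ⋯ τ ] (λ i → coeff κ i (toℕ m)) * X ^ toℕ m)
      ≡⟨ sum-cong-≗ {suc τ} (λ m → trans (cong (_* X ^ toℕ m) (sum-coeff κ τ (toℕ m)))
           (*-distribʳ-sum {suc τ} (X ^ toℕ m) (λ i → coeff κ (toℕ i) (toℕ m)))) ⟩
    ∑[ m ≤ τ ] ∑[ i ≤ τ ] (coeff κ (toℕ i) (toℕ m) * X ^ toℕ m)
      ≡⟨ ∑-comm {suc τ} {suc τ} (λ m i → coeff κ (toℕ i) (toℕ m) * X ^ toℕ m) ⟩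
    ∑[ i ≤ τ ] ∑[ m ≤ τ ] (coeff κ (toℕ i) (toℕ m) * X ^ toℕ m)
      ≡⟨ sum-cong-≗ {suc τ} (λ i → column (toℕ i) (ℕ.≤-pred (toℕ<n i))) ⟩
    ∑[ i ≤ τ ] fromℕ-ℚ ((k C toℕ i) ℕ.* κ (toℕ i))
      ≡⟨ ι-sum (suc τ) (λ i → (k C toℕ i) ℕ.* κ (toℕ i)) ⟨
    fromℕ-ℚ (ℕΣ.sum {suc τ} (λ i → (k C toℕ i) ℕ.* κ (toℕ i))) ∎
    where
    X = fromℕ-ℚ k

    column : ∀ i → i ℕ.≤ τ → ∑[ m ≤ τ ] (coeff κ i (toℕ m) * X ^ toℕ m) ≡ fromℕ-ℚ ((k C i) ℕ.* κ i)
    column i i≤τ = begin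
      ∑[ m ≤ τ ] (coeff κ i (toℕ m) * X ^ toℕ m)
        ≡⟨ sum-cong-≗ {suc τ} (λ m → solve 4 (λ a b c d → a :* b :* c :* d := a :* c :* (b :* d)) refl
             (fromℕ-ℚ (κ i)) (ι (s i (toℕ m))) (1/ i !) (X ^ toℕ m)) ⟩
      ∑[ m ≤ τ ] (fromℕ-ℚ (κ i) * 1/ i ! * (ι (s i (toℕ m)) * X ^ toℕ m))
        ≡⟨ *-distribˡ-sum {suc τ} (fromℕ-ℚ (κ i) * 1/ i !) (λ m → ι (s i (toℕ m)) * X ^ toℕ m) ⟨
      fromℕ-ℚ (κ i) * 1/ i ! * (∑[ m ≤ τ ] (ι (s i (toℕ m)) * X ^ toℕ m))
        ≡⟨ cong (fromℕ-ℚ (κ i) * 1/ i ! *_) (trans (sum-s X i τ i≤τ) (sym (C*!≡falling k i))) ⟩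
      fromℕ-ℚ (κ i) * 1/ i ! * (fromℕ-ℚ (k C i) * fromℕ-ℚ (i !))
        ≡⟨ solve 4 (λ a b c d → a :* b :* (c :* d) := b :* d :* (c :* a)) refl
             (fromℕ-ℚ (κ i)) (1/ i !) (fromℕ-ℚ (k C i)) (fromℕ-ℚ (i !)) ⟩
      1/ i ! * fromℕ-ℚ (i !) * (fromℕ-ℚ (k C i) * fromℕ-ℚ (κ i))
        ≡⟨ cong₂ _*_ (1/n*n≡1 (i !) {{i ℕ.!≢0}})
             (trans (sym (ι-* (+ (k C i)) (+ κ i))) (cong ι (sym (ℤ.pos-* (k C i) (κ i))))) ⟩
      1ℚ * fromℕ-ℚ ((k C i) ℕ.* κ i)
        ≡⟨ *-identityˡ _ ⟩
      fromℕ-ℚ ((k C i) ℕ.* κ i) ∎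

-- Floors, exponentials and logarithms of real numbers

module Reals (𝓡 : RealNumbers) where
  open RealNumbers 𝓡
  open Factorizations 𝓡
  open import Algebra.Properties.Ring ring
    using (-‿involutive; -0#≈0#; //-rightDividesˡ; +-cancelʳ; -‿anti-homo-+; -‿distribˡ-*)
  open import Algebra.Properties.Semiring.Mult semiring using (×-homo-+; ×1-homo-*)
  open import Algebra.Solver.Ring.NaturalCoefficients.Default commutativeSemiring
    using (solve; _:+_; _:*_; _:=_)
  open import Data.Integer.Base as ℤ using (-[1+_]; ∣_∣)
  import Data.Integer.Properties as ℤ
  open import Data.Nat.Base as ℕ using (z≤n; s≤s; _^_)
  import Data.Nat.Properties as ℕ
  open import Data.Sum.Base using (inj₁; inj₂)
  open import Level using (0ℓ)
  open import Relation.Binary.Bundles using (DecTotalOrder)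

  ≤-decTotalOrder : DecTotalOrder 0ℓ 0ℓ 0ℓ
  ≤-decTotalOrder = record { isDecTotalOrder = isDecTotalOrder }

  open DecTotalOrder ≤-decTotalOrder using (poset; total; antisym)
    renaming (refl to ≤-refl; trans to ≤-trans; reflexive to ≤-reflexive)
  open import Relation.Binary.Properties.DecTotalOrder ≤-decTotalOrder
    using (<⇒≉; ≤∧≉⇒<; <⇒≱; ≰⇒>; ≮⇒≥)
  open import Relation.Binary.Reasoning.PartialOrder poset

  +-monoʳ-≤ : ∀ w {y z} → y ≤ z → w + y ≤ w + z
  +-monoʳ-≤ w {y} {z} y≤z = begin
    w + y ≈⟨ +-comm w y ⟩
    y + w ≤⟨ +-monoˡ-≤ w y≤z ⟩
    z + w ≈⟨ +-comm z w ⟩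
    w + z ∎

  +-cancelʳ-≤ : ∀ w {y z} → y + w ≤ z + w → y ≤ z
  +-cancelʳ-≤ w {y} {z} y+w≤z+w = begin
    y             ≈⟨ cancel y ⟨
    (y + w) - w   ≤⟨ +-monoˡ-≤ (- w) y+w≤z+w ⟩
    (z + w) - w   ≈⟨ cancel z ⟩
    z             ∎
    where
    cancel : ∀ u → (u + w) - w ≈ u
    cancel u = trans (+-assoc u w (- w)) (trans (+-congˡ (-‿inverseʳ w)) (+-identityʳ u))

  ≤⇒0≤- : ∀ {y z} → y ≤ z → 0# ≤ z - y
  ≤⇒0≤- {y} {z} y≤z = begin
    0#     ≈⟨ -‿inverseʳ y ⟨
    y - y  ≤⟨ +-monoˡ-≤ (- y) y≤z ⟩
    z - y  ∎

  neg-antimono-≤ : ∀ {y z} → y ≤ z → - z ≤ - y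
  neg-antimono-≤ {y} {z} y≤z = +-cancelʳ-≤ z (begin
    - z + z  ≈⟨ -‿inverseˡ z ⟩
    0#       ≤⟨ ≤⇒0≤- y≤z ⟩
    z - y    ≈⟨ +-comm z (- y) ⟩
    - y + z  ∎)

  *-monoˡ-≤ : ∀ {w y z} → 0# ≤ w → y ≤ z → y * w ≤ z * w
  *-monoˡ-≤ {w} {y} {z} 0≤w y≤z = begin
    y * w                ≈⟨ +-identityˡ (y * w) ⟨
    0# + y * w           ≤⟨ +-monoˡ-≤ (y * w) (*-nonNeg (≤⇒0≤- y≤z) 0≤w) ⟩
    (z - y) * w + y * w  ≈⟨ distribʳ w (z - y) y ⟨
    (z - y + y) * w      ≈⟨ *-congʳ (//-rightDividesˡ y z) ⟩
    z * w                ∎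

  *-cancelʳ : ∀ {w y z} → ¬ (w ≈ 0#) → y * w ≈ z * w → y ≈ z
  *-cancelʳ {w} {y} {z} w≉0 yw≈zw = trans (sym (cancel y)) (trans (*-congʳ yw≈zw) (cancel z))
    where
    cancel : ∀ u → u * w * w ⁻¹ ≈ u
    cancel u = trans (*-assoc u w (w ⁻¹)) (trans (*-congˡ (⁻¹-inverse w w≉0)) (*-identityʳ u))

  >⇒≉ : ∀ {y z} → y < z → ¬ (z ≈ y)
  >⇒≉ y<z z≈y = <⇒≉ y<z (sym z≈y)

  <-≤-trans : ∀ {y z w} → y < z → z ≤ w → y < w
  <-≤-trans {y} {z} {w} y<z z≤w = begin-strict
    y <⟨ y<z ⟩
    z ≤⟨ z≤w ⟩
    w ∎

  *-cancelʳ-≤ : ∀ {w y z} → 0# < w → y * w ≤ z * w → y ≤ z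
  *-cancelʳ-≤ {w} {y} {z} 0<w yw≤zw = ≮⇒≥ λ z<y → <⇒≉ z<y
    (*-cancelʳ (>⇒≉ 0<w) (antisym (*-monoˡ-≤ (proj₁ 0<w) (proj₁ z<y)) yw≤zw))

  0<1 : 0# < 1#
  0<1 = ≤∧≉⇒< 0≤1 0≉1
    where
    0≤1 : 0# ≤ 1#
    0≤1 with total 0# 1#
    ... | inj₁ 0≤1 = 0≤1
    ... | inj₂ 1≤0 = begin
      0#             ≤⟨ *-nonNeg 0≤-1 0≤-1 ⟩
      - 1# * - 1#    ≈⟨ -‿distribˡ-* 1# (- 1#) ⟨
      - (1# * - 1#)  ≈⟨ -‿cong (*-identityˡ (- 1#)) ⟩
      - - 1#         ≈⟨ -‿involutive 1# ⟩
      1#             ∎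
      where
      0≤-1 : 0# ≤ - 1#
      0≤-1 = ≤-trans (≤-reflexive (sym -0#≈0#)) (neg-antimono-≤ 1≤0)

  y≤1+y : ∀ y → y ≤ 1# + y
  y≤1+y y = begin
    y       ≈⟨ +-identityˡ y ⟨
    0# + y  ≤⟨ +-monoˡ-≤ y (proj₁ 0<1) ⟩
    1# + y  ∎

  ⁻¹-nonNeg : ∀ {y} → 0# < y → 0# ≤ y ⁻¹
  ⁻¹-nonNeg {y} 0<y = *-cancelʳ-≤ 0<y (begin
    0# * y    ≈⟨ zeroˡ y ⟩
    0#        ≤⟨ proj₁ 0<1 ⟩
    1#        ≈⟨ ⁻¹-inverse y (>⇒≉ 0<y) ⟨
    y * y ⁻¹  ≈⟨ *-comm y (y ⁻¹) ⟩
    y ⁻¹ * y  ∎)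

  ÷-* : ∀ y {z} → 0# < z → (y ÷ z) * z ≈ y
  ÷-* y {z} 0<z = trans (*-assoc y (z ⁻¹) z)
    (trans (*-congˡ (trans (*-comm (z ⁻¹) z) (⁻¹-inverse z (>⇒≉ 0<z)))) (*-identityʳ y))

  fromℕ-nonNeg : ∀ n → 0# ≤ fromℕ n
  fromℕ-nonNeg zero    = ≤-refl
  fromℕ-nonNeg (suc n) = ≤-trans (fromℕ-nonNeg n) (y≤1+y (fromℕ n))

  fromℕ-mono-≤ : ∀ {m n} → m ℕ.≤ n → fromℕ m ≤ fromℕ n
  fromℕ-mono-≤ {n = n} z≤n = fromℕ-nonNeg n
  fromℕ-mono-≤ (s≤s m≤n)   = +-monoʳ-≤ 1# (fromℕ-mono-≤ m≤n)

  fromℕ-cancel-< : ∀ {m n} → fromℕ m < fromℕ n → m ℕ.< n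
  fromℕ-cancel-< m<n = ℕ.≰⇒> λ n≤m → <⇒≱ m<n (fromℕ-mono-≤ n≤m)

  fromℕ-<-suc : ∀ n → fromℕ n < fromℕ (suc n)
  fromℕ-<-suc n = ≤∧≉⇒< (y≤1+y (fromℕ n)) λ n≈1+n →
    0≉1 (+-cancelʳ (fromℕ n) 0# 1# (trans (+-identityˡ (fromℕ n)) n≈1+n))

  fromℕ-cancel-≤ : ∀ {m n} → fromℕ m ≤ fromℕ n → m ℕ.≤ n
  fromℕ-cancel-≤ {m} {n} m≤n = ℕ.≤-pred (fromℕ-cancel-< (begin-strict
    fromℕ m        ≤⟨ m≤n ⟩
    fromℕ n        <⟨ fromℕ-<-suc n ⟩
    fromℕ (suc n)  ∎))

  fromℕ-mono-< : ∀ {m n} → m ℕ.< n → fromℕ m < fromℕ n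
  fromℕ-mono-< {m} {n} m<n = begin-strict
    fromℕ m        <⟨ fromℕ-<-suc m ⟩
    fromℕ (suc m)  ≤⟨ fromℕ-mono-≤ m<n ⟩
    fromℕ n        ∎

  fromℕ-pos : ∀ {n} → 1 ℕ.≤ n → 0# < fromℕ n
  fromℕ-pos = fromℕ-mono-<

  fromℕ-+ : ∀ m n → fromℕ (m ℕ.+ n) ≈ fromℕ m + fromℕ n
  fromℕ-+ = ×-homo-+ 1#

  fromℕ-* : ∀ m n → fromℕ (m ℕ.* n) ≈ fromℕ m * fromℕ n
  fromℕ-* = ×1-homo-*

  fromℕ-cong : ∀ {m n} → m ≡ n → fromℕ m ≈ fromℕ n
  fromℕ-cong ≡.refl = refl

  fromℤ-nonNeg : ∀ {y} z → 0# ≤ y → y < fromℤ z + 1# → fromℤ z ≈ fromℕ ∣ z ∣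
  fromℤ-nonNeg     (ℤ.+ n)  _   _     = refl
  fromℤ-nonNeg {y} -[1+ n ] 0≤y y<z+1 = contradiction (begin
    - (1# + fromℕ n) + 1#   ≈⟨ +-congʳ (-‿anti-homo-+ 1# (fromℕ n)) ⟩
    - fromℕ n - 1# + 1#     ≈⟨ //-rightDividesˡ 1# (- fromℕ n) ⟩
    - fromℕ n               ≤⟨ neg-antimono-≤ (fromℕ-nonNeg n) ⟩
    - 0#                    ≈⟨ -0#≈0# ⟩
    0#                      ≤⟨ 0≤y ⟩
    y                       ∎) (<⇒≱ y<z+1)

  ⌊⌋-nonNeg : ∀ {y} → 0# ≤ y → fromℤ ⌊ y ⌋ ≈ fromℕ ∣ ⌊ y ⌋ ∣
  ⌊⌋-nonNeg {y} 0≤y = fromℤ-nonNeg ⌊ y ⌋ 0≤y (<-floor y)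

  -- For y ≥ 0, the natural numbers q ≤ y are those with q ≤ ∣ ⌊ y ⌋ ∣.
  ≤⇒≤⌊⌋ : ∀ q {y} → fromℕ q ≤ y → q ℕ.≤ ∣ ⌊ y ⌋ ∣
  ≤⇒≤⌊⌋ q {y} q≤y = ℕ.≤-pred (fromℕ-cancel-< (begin-strict
    fromℕ q               ≤⟨ q≤y ⟩
    y                     <⟨ <-floor y ⟩
    fromℤ ⌊ y ⌋ + 1#      ≈⟨ +-congʳ (⌊⌋-nonNeg (≤-trans (fromℕ-nonNeg q) q≤y)) ⟩
    fromℕ ∣ ⌊ y ⌋ ∣ + 1#  ≈⟨ +-comm _ 1# ⟩
    1# + fromℕ ∣ ⌊ y ⌋ ∣  ∎))

  ≤⌊⌋⇒≤ : ∀ q {y} → 0# ≤ y → q ℕ.≤ ∣ ⌊ y ⌋ ∣ → fromℕ q ≤ y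
  ≤⌊⌋⇒≤ q {y} 0≤y q≤⌊y⌋ = begin
    fromℕ q          ≤⟨ fromℕ-mono-≤ q≤⌊y⌋ ⟩
    fromℕ ∣ ⌊ y ⌋ ∣  ≈⟨ ⌊⌋-nonNeg 0≤y ⟨
    fromℤ ⌊ y ⌋      ≤⟨ floor-≤ y ⟩
    y                ∎

  -- For y = M z with M ≥ 1 and y, z ≥ 0, M q ≤ ⌊ y ⌋ exactly when q ≤ ⌊ z ⌋.
  *≤⌊⌋⇒≤⌊⌋ : ∀ M {y z} → 1 ℕ.≤ M → 0# ≤ y → y ≈ fromℕ M * z → ∀ q →
             M ℕ.* q ℕ.≤ ∣ ⌊ y ⌋ ∣ → q ℕ.≤ ∣ ⌊ z ⌋ ∣
  *≤⌊⌋⇒≤⌊⌋ M {y} {z} 1≤M 0≤y y≈Mz q Mq≤ = ≤⇒≤⌊⌋ q (*-cancelʳ-≤ (fromℕ-pos 1≤M) (begin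
    fromℕ q * fromℕ M  ≈⟨ *-comm (fromℕ q) (fromℕ M) ⟩
    fromℕ M * fromℕ q  ≈⟨ fromℕ-* M q ⟨
    fromℕ (M ℕ.* q)    ≤⟨ ≤⌊⌋⇒≤ (M ℕ.* q) 0≤y Mq≤ ⟩
    y                  ≈⟨ y≈Mz ⟩
    fromℕ M * z        ≈⟨ *-comm (fromℕ M) z ⟩
    z * fromℕ M        ∎))

  ≤⌊⌋⇒*≤⌊⌋ : ∀ M {y z} → 0# ≤ z → y ≈ fromℕ M * z → ∀ q →
             q ℕ.≤ ∣ ⌊ z ⌋ ∣ → M ℕ.* q ℕ.≤ ∣ ⌊ y ⌋ ∣
  ≤⌊⌋⇒*≤⌊⌋ M {y} {z} 0≤z y≈Mz q q≤ = ≤⇒≤⌊⌋ (M ℕ.* q) (begin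
    fromℕ (M ℕ.* q)    ≈⟨ fromℕ-* M q ⟩
    fromℕ M * fromℕ q  ≈⟨ *-comm (fromℕ M) (fromℕ q) ⟩
    fromℕ q * fromℕ M  ≤⟨ *-monoˡ-≤ (fromℕ-nonNeg M) (≤⌊⌋⇒≤ q 0≤z q≤) ⟩
    z * fromℕ M        ≈⟨ *-comm z (fromℕ M) ⟩
    fromℕ M * z        ≈⟨ y≈Mz ⟨
    y                  ∎)

  -fromℤ≤ : ∀ z → - fromℤ z ≤ fromℕ ∣ z ∣
  -fromℤ≤ (ℤ.+ n) = begin
    - fromℕ n  ≤⟨ neg-antimono-≤ (fromℕ-nonNeg n) ⟩
    - 0#       ≈⟨ -0#≈0# ⟩
    0#         ≤⟨ fromℕ-nonNeg n ⟩
    fromℕ n    ∎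
  -fromℤ≤ -[1+ n ] = ≤-reflexive (-‿involutive (fromℕ (suc n)))

  -- True for y of either sign, since y ≤ ⌈ y ⌉ ≤ ∣ ⌈ y ⌉ ∣.
  ≤∣⌈⌉∣ : ∀ y → y ≤ fromℕ ∣ ⌈ y ⌉ ∣
  ≤∣⌈⌉∣ y = begin
    y                   ≈⟨ -‿involutive y ⟨
    - - y               ≤⟨ neg-antimono-≤ (floor-≤ (- y)) ⟩
    - fromℤ ⌊ - y ⌋     ≤⟨ -fromℤ≤ ⌊ - y ⌋ ⟩
    fromℕ ∣ ⌊ - y ⌋ ∣   ≈⟨ fromℕ-cong (≡.sym (ℤ.∣-i∣≡∣i∣ ⌊ - y ⌋)) ⟩
    fromℕ ∣ ⌈ y ⌉ ∣     ∎

  exp-nonNeg⇒1≤ : ∀ {y} → 0# ≤ y → 1# ≤ exp y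
  exp-nonNeg⇒1≤ {y} 0≤y = begin
    1#       ≈⟨ +-identityʳ 1# ⟨
    1# + 0#  ≤⟨ +-monoʳ-≤ 1# 0≤y ⟩
    1# + y   ≤⟨ 1+y≤exp-y y ⟩
    exp y    ∎

  exp-0 : exp 0# ≈ 1#
  exp-0 = *-cancelʳ (>⇒≉ (<-≤-trans 0<1 (exp-nonNeg⇒1≤ ≤-refl)))
    (trans (sym (exp-+ 0# 0#)) (trans (exp-cong (+-identityʳ 0#)) (sym (*-identityˡ (exp 0#)))))

  exp-inverse : ∀ y → exp y * exp (- y) ≈ 1#
  exp-inverse y = trans (sym (exp-+ y (- y))) (trans (exp-cong (-‿inverseʳ y)) exp-0)

  -- For y ≤ 0 the sign of exp y is that of 1 = exp y · exp (- y), as exp (- y) ≥ 1.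
  exp-pos : ∀ y → 0# < exp y
  exp-pos y = ≤∧≉⇒< nonNeg λ 0≈exp →
    0≉1 (trans (sym (zeroˡ (exp (- y)))) (trans (*-congʳ 0≈exp) (exp-inverse y)))
    where
    nonNeg : 0# ≤ exp y
    nonNeg with total 0# y
    ... | inj₁ 0≤y = ≤-trans (proj₁ 0<1) (exp-nonNeg⇒1≤ 0≤y)
    ... | inj₂ y≤0 = *-cancelʳ-≤ (<-≤-trans 0<1 (exp-nonNeg⇒1≤ 0≤-y)) (begin
      0# * exp (- y)     ≈⟨ zeroˡ (exp (- y)) ⟩
      0#                 ≤⟨ proj₁ 0<1 ⟩
      1#                 ≈⟨ exp-inverse y ⟨
      exp y * exp (- y)  ∎)
      where
      0≤-y : 0# ≤ - y
      0≤-y = ≤-trans (≤-reflexive (sym -0#≈0#)) (neg-antimono-≤ y≤0)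

  -- The graph of exp lies above its tangent at y: this is 1 + w ≤ exp w for
  -- w = z - y, multiplied by exp y.
  exp-tangent : ∀ y z → (1# + (z - y)) * exp y ≤ exp z
  exp-tangent y z = begin
    (1# + (z - y)) * exp y  ≤⟨ *-monoˡ-≤ (proj₁ (exp-pos y)) (1+y≤exp-y (z - y)) ⟩
    exp (z - y) * exp y     ≈⟨ exp-+ (z - y) y ⟨
    exp (z - y + y)         ≈⟨ exp-cong (//-rightDividesˡ y z) ⟩
    exp z                   ∎

  -- If exp y ≤ exp z, the tangent at z gives 1 + (y - z) ≤ 1.
  exp-cancel-≤ : ∀ {y z} → exp y ≤ exp z → y ≤ z
  exp-cancel-≤ {y} {z} ey≤ez = +-cancelʳ-≤ (- z) (begin
    y - z  ≤⟨ +-cancelʳ-≤ 1# (begin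
      y - z + 1#    ≈⟨ +-comm (y - z) 1# ⟩
      1# + (y - z)  ≤⟨ *-cancelʳ-≤ (exp-pos z) (begin
        (1# + (y - z)) * exp z  ≤⟨ exp-tangent z y ⟩
        exp y                   ≤⟨ ey≤ez ⟩
        exp z                   ≈⟨ *-identityˡ (exp z) ⟨
        1# * exp z              ∎) ⟩
      1#            ≈⟨ +-identityˡ 1# ⟨
      0# + 1#       ∎) ⟩
    0#     ≈⟨ -‿inverseʳ z ⟨
    z - z  ∎)

  exp-mono-≤ : ∀ {y z} → y ≤ z → exp y ≤ exp z
  exp-mono-≤ {y} {z} y≤z = begin
    exp y                   ≈⟨ *-identityˡ (exp y) ⟨
    1# * exp y              ≤⟨ *-monoˡ-≤ (proj₁ (exp-pos y)) (begin
      1#            ≈⟨ +-identityʳ 1# ⟨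
      1# + 0#       ≤⟨ +-monoʳ-≤ 1# (≤⇒0≤- y≤z) ⟩
      1# + (z - y)  ∎) ⟩
    (1# + (z - y)) * exp y  ≤⟨ exp-tangent y z ⟩
    exp z                   ∎

  exp-cancel-< : ∀ {y z} → exp y < exp z → y < z
  exp-cancel-< ey<ez = ≰⇒> λ z≤y → <⇒≱ ey<ez (exp-mono-≤ z≤y)

  log-mono-< : ∀ {y z} → 0# < y → y < z → log y < log z
  log-mono-< {y} {z} 0<y y<z = exp-cancel-< (begin-strict
    exp (log y)  ≈⟨ exp-log y 0<y ⟩
    y            <⟨ y<z ⟩
    z            ≈⟨ exp-log z (<-≤-trans 0<y (proj₁ y<z)) ⟨
    exp (log z)  ∎)

  log-nonNeg : ∀ {y} → 1# ≤ y → 0# ≤ log y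
  log-nonNeg {y} 1≤y = exp-cancel-≤ (begin
    exp 0#       ≈⟨ exp-0 ⟩
    1#           ≤⟨ 1≤y ⟩
    y            ≈⟨ exp-log y (<-≤-trans 0<1 1≤y) ⟨
    exp (log y)  ∎)

  log-pos : ∀ {y} → 1# < y → 0# < log y
  log-pos {y} 1<y = exp-cancel-< (begin-strict
    exp 0#       ≈⟨ exp-0 ⟩
    1#           <⟨ 1<y ⟩
    y            ≈⟨ exp-log y (<-≤-trans 0<1 (proj₁ 1<y)) ⟨
    exp (log y)  ∎)

  exp-log-^ : ∀ {l} → 1 ℕ.≤ l → ∀ n → exp (fromℕ n * log (fromℕ l)) ≈ fromℕ (l ^ n)
  exp-log-^ {l} 1≤l zero    = trans (exp-cong (zeroˡ _)) (trans exp-0 (sym (+-identityʳ 1#)))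
  exp-log-^ {l} 1≤l (suc n) = begin-equality
    exp ((1# + fromℕ n) * L)
      ≈⟨ exp-cong (trans (distribʳ L 1# (fromℕ n)) (+-congʳ (*-identityˡ L))) ⟩
    exp (L + fromℕ n * L)        ≈⟨ exp-+ L (fromℕ n * L) ⟩
    exp L * exp (fromℕ n * L)    ≈⟨ *-cong (exp-log (fromℕ l) (fromℕ-pos 1≤l)) (exp-log-^ 1≤l n) ⟩
    fromℕ l * fromℕ (l ^ n)      ≈⟨ fromℕ-* l (l ^ n) ⟨
    fromℕ (l ℕ.* l ^ n)          ∎
    where L = log (fromℕ l)

  module _ {l : ℕ} (2≤l : 2 ℕ.≤ l) where
    private
      L L⁺ : ℝ
      L = log (fromℕ l)
      L⁺ = log (fromℕ (suc l))

      1≤l : 1 ℕ.≤ l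
      1≤l = ℕ.<⇒≤ 2≤l

      0<L : 0# < L
      0<L = log-pos (begin-strict
        1#       ≈⟨ +-identityʳ 1# ⟨
        fromℕ 1  <⟨ fromℕ-mono-< 2≤l ⟩
        fromℕ l  ∎)

    xᵢ-nonNeg : ∀ φ j i → 0# ≤ xᵢ φ l j i
    xᵢ-nonNeg φ j i = *-nonNeg (proj₁ (exp-pos _)) (fromℕ-nonNeg (l ^ (i ℕ.+ j)))

    -- With b = log_l x, x = l ^ (frac b) · l ^ ⌊ b ⌋.
    x-decomposition : ∀ {x} → 1# ≤ x → (l ^ʳ frac (logBase l x)) * fromℕ (l ^ t x l) ≈ x
    x-decomposition {x} 1≤x = begin-equality
      exp (φ * L) * fromℕ (l ^ n)       ≈⟨ *-congˡ (exp-log-^ 1≤l n) ⟨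
      exp (φ * L) * exp (fromℕ n * L)   ≈⟨ exp-+ (φ * L) (fromℕ n * L) ⟨
      exp (φ * L + fromℕ n * L)         ≈⟨ exp-cong (distribʳ L φ (fromℕ n)) ⟨
      exp ((φ + fromℕ n) * L)           ≈⟨ exp-cong (*-congʳ (+-congˡ (⌊⌋-nonNeg 0≤b))) ⟨
      exp ((φ + fromℤ ⌊ b ⌋) * L)
        ≈⟨ exp-cong (*-congʳ (//-rightDividesˡ (fromℤ ⌊ b ⌋) b)) ⟩
      exp (b * L)                       ≈⟨ exp-cong (÷-* (log x) 0<L) ⟩
      exp (log x)                       ≈⟨ exp-log x (<-≤-trans 0<1 1≤x) ⟩
      x                                 ∎
      where
      b = logBase l x
      φ = frac b
      n = t x l

      0≤b : 0# ≤ b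
      0≤b = *-nonNeg (log-nonNeg 1≤x) (⁻¹-nonNeg 0<L)

    x≈l^*xᵢ : ∀ {x} → 1# ≤ x → ∀ {i j} → j ℕ.≤ t x l → i ℕ.≤ t x l ∸ j →
              x ≈ fromℕ (l ^ (t x l ∸ j ∸ i)) * xᵢ (frac (logBase l x)) l j i
    x≈l^*xᵢ {x} 1≤x {i} {j} j≤t i≤t-j = begin-equality
      x                                         ≈⟨ x-decomposition 1≤x ⟨
      a * fromℕ (l ^ t x l)                     ≈⟨ *-congˡ (fromℕ-cong split) ⟩
      a * fromℕ (l ^ (k ∸ i) ℕ.* l ^ (i ℕ.+ j)) ≈⟨ *-congˡ (fromℕ-* (l ^ (k ∸ i)) (l ^ (i ℕ.+ j))) ⟩
      a * (M * N)
        ≈⟨ solve 3 (λ a M N → a :* (M :* N) := M :* (a :* N)) refl a M N ⟩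
      M * (a * N)                               ∎
      where
      a = l ^ʳ frac (logBase l x)
      k = t x l ∸ j
      M = fromℕ (l ^ (k ∸ i))
      N = fromℕ (l ^ (i ℕ.+ j))

      exponent : k ∸ i ℕ.+ (i ℕ.+ j) ≡ t x l
      exponent = ≡.trans (≡.sym (ℕ.+-assoc (k ∸ i) i j))
        (≡.trans (≡.cong (ℕ._+ j) (ℕ.m∸n+n≡m i≤t-j)) (ℕ.m∸n+n≡m j≤t))

      split : l ^ t x l ≡ l ^ (k ∸ i) ℕ.* l ^ (i ℕ.+ j)
      split = ≡.trans (≡.cong (l ^_) (≡.sym exponent)) (ℕ.^-distribˡ-+-* l (k ∸ i) (i ℕ.+ j))

    -- If (l + 1) ^ i ≤ xᵢ, then taking logarithms i log (l + 1) ≤ (φ + i + j) log l,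
    -- that is, i ≤ (φ log l + j log l) / (log (l + 1) - log l).
    ⌊xᵢ⌋<[l+1]^i : ∀ φ j i →
      ∣ ⌈ (φ * L + fromℕ j * L) ÷ (L⁺ - L) ⌉ ∣ ℕ.< i → ∣ ⌊ xᵢ φ l j i ⌋ ∣ ℕ.< suc l ^ i
    ⌊xᵢ⌋<[l+1]^i φ j i c<i = ℕ.≰⇒> λ [l+1]^i≤⌊xᵢ⌋ → ℕ.<⇒≱ c<i (fromℕ-cancel-≤ (begin
      fromℕ i         ≤⟨ *-cancelʳ-≤ 0<D (bound (≤⌊⌋⇒≤ (suc l ^ i) (xᵢ-nonNeg φ j i) [l+1]^i≤⌊xᵢ⌋)) ⟩
      A               ≤⟨ ≤∣⌈⌉∣ A ⟩
      fromℕ ∣ ⌈ A ⌉ ∣ ∎))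
      where
      I = fromℕ i
      J = fromℕ j
      D = L⁺ - L
      A = (φ * L + J * L) ÷ D

      0<D : 0# < D
      0<D = ≤∧≉⇒< (≤⇒0≤- (proj₁ L<L⁺)) λ 0≈D → <⇒≉ L<L⁺
        (trans (sym (+-identityˡ L)) (trans (+-congʳ 0≈D) (//-rightDividesˡ L L⁺)))
        where
        L<L⁺ : L < L⁺
        L<L⁺ = log-mono-< (fromℕ-pos 1≤l) (fromℕ-<-suc l)

      bound : fromℕ (suc l ^ i) ≤ xᵢ φ l j i → I * D ≤ A * D
      bound [l+1]^i≤xᵢ = +-cancelʳ-≤ (I * L) (begin
        I * D + I * L            ≈⟨ distribˡ I D L ⟨
        I * (D + L)              ≈⟨ *-congˡ (//-rightDividesˡ L L⁺) ⟩
        I * L⁺                   ≤⟨ exp-cancel-≤ (begin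
          exp (I * L⁺)                             ≈⟨ exp-log-^ (s≤s z≤n) i ⟩
          fromℕ (suc l ^ i)                        ≤⟨ [l+1]^i≤xᵢ ⟩
          exp (φ * L) * fromℕ (l ^ (i ℕ.+ j))      ≈⟨ *-congˡ (exp-log-^ 1≤l (i ℕ.+ j)) ⟨
          exp (φ * L) * exp (fromℕ (i ℕ.+ j) * L)  ≈⟨ exp-+ (φ * L) _ ⟨
          exp (φ * L + fromℕ (i ℕ.+ j) * L)        ∎) ⟩
        φ * L + fromℕ (i ℕ.+ j) * L  ≈⟨ +-congˡ (*-congʳ (fromℕ-+ i j)) ⟩
        φ * L + (I + J) * L
          ≈⟨ solve 4 (λ φ L I J → φ :* L :+ (I :+ J) :* L := φ :* L :+ J :* L :+ I :* L)
               refl φ L I J ⟩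
        φ * L + J * L + I * L        ≈⟨ +-congʳ (÷-* (φ * L + J * L) 0<D) ⟨
        A * D + I * L                ∎)

-- The polynomial formula for F

theorem3p1 : (𝓡 : RealNumbers) →
    let open RealNumbers 𝓡 in
    let open Factorizations 𝓡 in
    (x : ℝ) → 1# ≤ x →
    (l : ℕ) → 2 ℕ.≤ l →
    (j : ℕ) → j ℕ.< t x l →
    fromℕ-ℚ (F (t x l ∸ j) x l)
    ≡ eval (P (frac (logBase l x)) l j (τ x j l)) (fromℕ-ℚ (t x l ∸ j))
theorem3p1 𝓡 x 1≤x l 2≤l j j<t = ≡.trans
  (≡.cong fromℕ-ℚ (count-binomial (λ i → ∣ ⌊ xᵢ φ l j i ⌋ ∣) 1≤l (ℕ.m⊓n≤m k _)
    (λ i i≤k → *≤⌊⌋⇒≤⌊⌋ (l ℕ.^ (k ∸ i)) (ℕ.m^n>0 l (k ∸ i)) 0≤x (scale i≤k))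
    (λ i i≤k → ≤⌊⌋⇒*≤⌊⌋ (l ℕ.^ (k ∸ i)) (xᵢ-nonNeg 2≤l φ j i) (scale i≤k))
    -- As τ is the minimum of k and the ceiling, τ < i ≤ k puts i above the ceiling.
    (λ i τ<i i≤k → ⌊xᵢ⌋<[l+1]^i 2≤l φ j i
      (ℕ.≰⇒> λ i≤c → ℕ.<⇒≱ τ<i (ℕ.⊓-glb i≤k i≤c)))))
  (≡.sym (eval-coeff (κ φ l j) (τ x j l) k))
  where
  open RealNumbers 𝓡
  open Factorizations 𝓡
  open Reals 𝓡
  open Tuples using (count-binomial)
  open Polynomials using (eval-coeff)

  φ = frac (logBase l x)
  k = t x l ∸ j

  1≤l : 1 ℕ.≤ l
  1≤l = ℕ.<⇒≤ 2≤l

  instance _ = ℕ.>-nonZero 1≤l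

  0≤x : 0# ≤ x
  0≤x = proj₁ (<-≤-trans 0<1 1≤x)

  scale : ∀ {i} → i ℕ.≤ k → x ≈ fromℕ (l ℕ.^ (k ∸ i)) * xᵢ φ l j i
  scale = x≈l^*xᵢ 2≤l 1≤x (ℕ.<⇒≤ j<t)
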